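{- Let $\mathcal{P}$ be a program. If $\mathcal{P}$ is terminating, then it can be decomposed into a finite set of certified modules, i.e. there are certified modules $(\mathcal{P}_1,f_1,\mathcal{I}_1),\dots,(\mathcal{P}_n,f_n,\mathcal{I}_n)$ such that $$\mathcal{L}(\mathcal{P})=\mathcal{L}(\mathcal{P}_1)\cup\dots\cup\mathcal{L}(\mathcal{P}_n).$$
   Context: **Statements, valuations, traces.** Fix a finite set $\Sigma$ of program statements and program variables $\vec{\mathsf{v}}$. A *valuation* $\nu$ is a function mapping the program variables to values. Each statement $st\in\Sigma$ comes with a binary relation on the set of valuations, its transition relation. An *$\omega$-trace* is an arbitrary infinite sequence $\pi=st_1st_2\ldots$ of statements from $\Sigma$. An $\omega$-trace is *terminating* if it has no infinite execution, i.e. there is no infinite sequence of valuations $\nu_0,\nu_1,\ldots$ with $(\nu_i,\nu_{i+1})$ in the transition relation of $st_{i+1}$ for all $i\ge 0$ (either because some finite prefix has no execution, or because every finite prefix is executable but no starting valuation admits an infinite execution). **Program.** A *program* is a graph $\mathcal{P}=\langle \mathsf{Loc},\delta,\ell_{\mathsf{init}}\rangle$ with a finite set $\mathsf{Loc}$ of locations, a set $\delta\subseteq\mathsf{Loc}\times\Sigma\times\mathsf{Loc}$ of labeled edges and an initial location $\ell_{\mathsf{init}}\in\mathsf{Loc}$. The $\omega$-traces of $\mathcal{P}$ are the label sequences of infinite paths starting in $\ell_{\mathsf{init}}$; the set of them is $\mathcal{L}(\mathcal{P})$ (the language of $\mathcal{P}$ viewed as a Büchi automaton with all locations final). The program is *terminating*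 if each of its $\omega$-traces is terminating. **Module.** A *module* is a program together with a distinguished (final) location, $\mathcal{P}=\langle \mathsf{Loc},\delta,\ell_{\mathsf{init}},\ell_{\mathsf{fin}}\rangle$, such that $\mathsf{Loc}$ can be partitioned into two disjoint sets $\mathsf{Loc}_U,\mathsf{Loc}_V$ with $\ell_{\mathsf{init}}\in\mathsf{Loc}_U$, $\ell_{\mathsf{fin}}\in\mathsf{Loc}_V$, and no location in $\mathsf{Loc}_V$ has a successor in $\mathsf{Loc}_U$ (i.e. $(\ell,st,\ell')\in\delta$ implies $\ell\in\mathsf{Loc}_U$ or $\ell'\in\mathsf{Loc}_V$). A *fair $\omega$-trace* of a module is an $\omega$-trace that labels an infinite path starting in $\ell_{\mathsf{init}}$ that visits $\ell_{\mathsf{fin}}$ infinitely often. For a module $\mathcal{P}_i$, $\mathcal{L}(\mathcal{P}_i)$ is the set of its fair $\omega$-traces (the language of $\mathcal{P}_i$ viewed as a Büchi automaton whose only final state is $\ell_{\mathsf{fin}}$). **Predicates, Hoare triples, auxiliary variable.** Let $(\mathbb{W},\prec)$ denote a well-ordered set containing an element $\infty$ that is strictly greater than all other elements of $\mathbb{W}$. Let $\mathtt{oldrnk}$ be an auxiliary variable with values in $\mathbb{W}$ that does not occur in the statements of the program (statements in $\Sigma$ neither depend on it nor modify it). A *predicate* is an arbitrary set of valuations of the program variables together with $\mathtt{oldrnk}$. The Hoare triple $\{I\}\,st\,\{I'\}$ is *valid* if every valuation reachable from a valuation in $I$ via the transition relation of $st$ lies in $I'$. The statement $\mathtt{oldrnk}:=f(\vec{\mathsf{v}})$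 assigns the value of $f$ at the current valuation of the program variables to $\mathtt{oldrnk}$ and leaves the program variables unchanged; ";" is sequential composition. **Certified module.** Given a module $\mathcal{P}=\langle \mathsf{Loc},\delta,\ell_{\mathsf{init}},\ell_{\mathsf{fin}}\rangle$ and a function $f$ from valuations (of the program variables) into a well-ordered set $(\mathbb{W},\prec)$ containing an element $\infty$ that is strictly greater than all other elements of $\mathbb{W}$, a mapping $\mathcal{I}$ from locations to predicates is a *rank certificate* for $f$ and $\mathcal{P}$ if: 1. $\mathcal{I}(\ell_{\mathsf{init}})\Leftrightarrow \mathtt{oldrnk}=\infty$; 2. $\mathcal{I}(\ell_{\mathsf{fin}})\Rightarrow f(\vec{\mathsf{v}})\prec\mathtt{oldrnk}$; 3. $\{\mathcal{I}(\ell)\}\ st\ \{\mathcal{I}(\ell')\}$ is valid for every $(\ell,st,\ell')\in\delta$ with $\ell\ne\ell_{\mathsf{fin}}$; 4. $\{\mathcal{I}(\ell_{\mathsf{fin}})\}\ \mathtt{oldrnk}:=f(\vec{\mathsf{v}});\,st\ \{\mathcal{I}(\ell')\}$ is valid for every $(\ell_{\mathsf{fin}},st,\ell')\in\delta$. The triple $(\mathcal{P},f,\mathcal{I})$ is then called a *certified module*. The well-ordered set is part of the data of $f$ and may be chosen for each certified module. -}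

module Defs where

open import Level using (Level; 0ℓ) renaming (suc to lsuc)
open import Data.Nat.Base using (ℕ; suc; _≤_)
open import Data.Fin.Base using (Fin)
open import Data.Fin.Subset using (_∈_; _∪_; _∩_; ⊤; Empty)
open import Data.Product using (Σ-syntax; ∃-syntax; _×_; _,_)
open import Data.Product.Relation.Binary.Pointwise.NonDependent using (Pointwise)
open import Data.Sum using (_⊎_)
open import Function.Bundles using (_⇔_)
open import Induction.WellFounded using (WellFounded)
open import Relation.Binary.Bundles using (StrictTotalOrder)
open import Relation.Binary.Core using (Rel)
open import Relation.Binary.Definitions using (_Respects_)
open import Relation.Binary.Construct.Composition using (_;_)
open import Relation.Binary.PropositionalEquality using (_≡_; _≢_)
open import Relation.Nullary using (¬_)
open import Relation.Unary using (Pred)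

record Statements (ℓ : Level) : Set (lsuc ℓ) where
  field
    #vars : ℕ
    Value : Set ℓ
    #stmts : ℕ

  Valuation : Set ℓ
  Valuation = Fin #vars → Value

  Stmt : Set
  Stmt = Fin #stmts

  ωTrace : Set
  ωTrace = ℕ → Stmt

  field
    ⟦_⟧ : Stmt → Rel Valuation ℓ

-- A well-ordered set with a greatest element.  Its equality is the setoid
-- equality _≈_ of the strict total order, which stands in for the equality
-- of a quotient (e.g. for ordinals represented by trees).
record WellOrder∞ (ℓ : Level) : Set (lsuc ℓ) where
  field
    strictTotalOrder : StrictTotalOrder ℓ ℓ ℓ

  open StrictTotalOrder strictTotalOrder public
    using (Carrier; _≈_) renaming (_<_ to _≺_)

  field
    ≺-wellFounded : WellFounded _≺_
    ∞ : Carrier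
    ≺∞ : ∀ w → ¬ (w ≈ ∞) → w ≺ ∞

module _ {ℓ : Level} (S : Statements ℓ) where
  open Statements S

  record Program : Set₁ where
    field
      #locs : ℕ

    Loc : Set
    Loc = Fin #locs

    field
      δ : Pred (Loc × Stmt × Loc) 0ℓ
      init : Loc

    IsPath : ωTrace → (ℕ → Loc) → Set
    IsPath π ρ = ρ 0 ≡ init × (∀ i → δ (ρ i , π i , ρ (suc i)))

  record Module : Set₁ where
    field
      program : Program

    open Program program public

    field
      fin : Loc
      partition : ∃[ U ] ∃[ V ]
        (U ∪ V ≡ ⊤) × Empty (U ∩ V) × init ∈ U × fin ∈ V ×
        (∀ {l st l′} → δ (l , st , l′) → l ∈ U ⊎ l′ ∈ V)

module _ {ℓ : Level} {S : Statements ℓ} where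
  open Statements S

  TerminatingTrace : ωTrace → Set ℓ
  TerminatingTrace π =
    ¬ (Σ[ ν ∈ (ℕ → Valuation) ] (∀ i → ⟦ π i ⟧ (ν i) (ν (suc i))))

  traces : Program S → Pred ωTrace 0ℓ
  traces P π = ∃[ ρ ] IsPath π ρ
    where open Program P

  Terminating : Program S → Set ℓ
  Terminating P = ∀ π → traces P π → TerminatingTrace π

  fairTraces : Module S → Pred ωTrace 0ℓ
  fairTraces M π = ∃[ ρ ] IsPath π ρ × (∀ i → ∃[ j ] i ≤ j × ρ j ≡ fin)
    where open Module M

module Assertions {ℓ : Level} (S : Statements ℓ) (W : WellOrder∞ ℓ) where
  open Statements S
  open WellOrder∞ W

  -- A valuation of the program variables paired with the value of oldrnk.
  State : Set ℓ
  State = Valuation × Carrier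

  -- As Carrier is a setoid, sets of states have to respect its equality.
  record Predicate : Set (lsuc ℓ) where
    field
      holds : Pred State ℓ
      respects : holds Respects Pointwise _≡_ _≈_

  open Predicate public

  exec : Stmt → Rel State ℓ
  exec st = Pointwise ⟦ st ⟧ _≈_

  oldrnk≔ : (Valuation → Carrier) → Rel State ℓ
  oldrnk≔ f (ν , _) (ν′ , r′) = ν ≡ ν′ × r′ ≈ f ν

  Valid⟨_⟩_⟨_⟩ : Predicate → Rel State ℓ → Predicate → Set ℓ
  Valid⟨ I ⟩ R ⟨ I′ ⟩ = ∀ {s s′} → holds I s → R s s′ → holds I′ s′

  record IsRankCertificate (M : Module S) (f : Valuation → Carrier)
                           (I : Module.Loc M → Predicate) : Set ℓ where
    open Module M
    field
      initial : ∀ ν r → holds (I init) (ν , r) ⇔ r ≈ ∞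
      final : ∀ ν r → holds (I fin) (ν , r) → f ν ≺ r
      step : ∀ {l st l′} → δ (l , st , l′) → l ≢ fin →
             Valid⟨ I l ⟩ exec st ⟨ I l′ ⟩
      step-fin : ∀ {st l′} → δ (fin , st , l′) →
                 Valid⟨ I fin ⟩ oldrnk≔ f ; exec st ⟨ I l′ ⟩

record CertifiedModule {ℓ : Level} (S : Statements ℓ) : Set (lsuc ℓ) where
  open Statements S
  field
    module′ : Module S
    W : WellOrder∞ ℓ

  open Assertions S W

  field
    f : Valuation → WellOrder∞.Carrier W
    I : Module.Loc module′ → Predicate
    isRankCertificate : IsRankCertificate module′ f I

{-# OPTIONS --safe #-}
module Submission where

-- Every infinite path of P visits some location infinitely often, because
-- there are finitely many locations.  So traces P is the union, over the
-- locations k of P, of the labels of the paths that visit k infinitely often.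
-- The module for k consists of P together with a fresh copy of the initial
-- location, which has the same outgoing edges as the original and no incoming
-- ones; its final location is k.  Then U contains just the copy, V is P itself,
-- and a path of the module differs from one of P in its first location only
-- (fairTraces⊆traces, traces⊆⋃fairTraces).
--
-- All modules share one ranking.  A configuration of P is a location paired
-- with a valuation, and P makes steps between configurations.  With a top
-- configuration added above all configurations and itself, compare
-- configurations by their ordinal rank for the step relation, all those that
-- start an infinite execution having the rank of the top.  This is a well-order
-- whose greatest element is the top (rankOrder).  A step from a configuration
-- of rank below the top makes the rank strictly smaller (⊏⇒rank-decreases), and
-- every configuration at the initial location has such a rank, as P is
-- terminating (Terminating⇒initial-acc).  The function f of the module for k maps ν to the
-- rank of (k , ν).  The certificate maps the copy to oldrnk = ∞, and each
-- location l of P to "the rank of (l , ν) is below oldrnk".  Each step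
-- decreases the rank, and the assignment to oldrnk at k sets it to
-- the rank of the current configuration, hence all Hoare triples are valid.

open import Defs
open import Level using (Level; Lift; lift; lower; 0ℓ)
open import Data.Nat using (ℕ; zero; suc; _≤_; _⊔_)
open import Data.Nat.Properties using (≤-trans; m≤m⊔n; m≤n⊔m; n≤1+n)
open import Data.Fin using (Fin; zero; suc)
open import Data.Fin.Subset using (_∈_; ⁅_⁆; ∁)
open import Data.Fin.Subset.Properties
  using (x∈⁅x⁆; p∪∁p≡⊤; x∈p∩q⁻; x∈p⇒x∉∁p; x∉p⇒x∈∁p; x≢y⇒x∉⁅y⁆)
open import Data.Empty using (⊥)
open import Data.Product
  using (Σ-syntax; ∃-syntax; _×_; _,_; proj₁; proj₂)
open import Data.Sum using (_⊎_; inj₁; inj₂)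
open import Function using (_∘_; mk⇔)
open import Induction.InfiniteDescent using (InfiniteDescendingSequenceFrom)
open import Induction.WellFounded using (WellFounded; Acc; acc; acc-inverse; wf⇒asym)
open import Relation.Binary.Bundles using (StrictTotalOrder)
open import Relation.Binary.Core using (Rel)
import Relation.Binary.Construct.Add.Supremum.NonStrict as AddTop
open import Relation.Binary.Definitions
  using (Asymmetric; Transitive; Trichotomous; tri<; tri≈; tri>)
open import Relation.Binary.PropositionalEquality using (_≡_; refl; sym; subst)
open import Relation.Binary.Structures using (IsEquivalence)
open import Relation.Binary.Structures.Biased using (isStrictTotalOrderᶜ)
open import Relation.Nullary using (¬_; yes; no)
open import Relation.Nullary.Construct.Add.Supremum using ([_]; ⊤⁺)
open import Relation.Nullary.Decidable using (map′)
open import Relation.Nullary.Negation using (contradiction)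
open import Relation.Unary using (_≐_; _⊆_; ⋃)
open import Axiom.ExcludedMiddle using (ExcludedMiddle)
open import Axiom.DoubleNegationElimination using (em⇒dne)

private
  variable
    ℓ : Level

-- Classical infinite sequences

em₀ : ExcludedMiddle ℓ → ExcludedMiddle 0ℓ
em₀ {ℓ} em {A} = map′ lower lift (em {Lift ℓ A})

upperBound : ∀ n (b : Fin n → ℕ) → ∃[ m ] (∀ k → b k ≤ m)
upperBound zero    b = 0 , λ ()
upperBound (suc n) b with m , b≤m ← upperBound n (b ∘ suc) =
  b zero ⊔ m , λ where
    zero    → m≤m⊔n (b zero) m
    (suc k) → ≤-trans (b≤m k) (m≤n⊔m (b zero) m)

infinitePigeonhole : ExcludedMiddle 0ℓ → ∀ {n} (ρ : ℕ → Fin n) →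
                     ∃[ k ] (∀ i → ∃[ j ] i ≤ j × ρ j ≡ k)
infinitePigeonhole em {n} ρ = dne λ ¬∃ →
  let noVisitFrom : ∀ k → ∃[ i ] ¬ (∃[ j ] i ≤ j × ρ j ≡ k)
      noVisitFrom k = dne λ ¬bound →
        ¬∃ (k , λ i → dne λ ¬later → ¬bound (i , ¬later))
      m , from≤m = upperBound n (proj₁ ∘ noVisitFrom)
  in proj₂ (noVisitFrom (ρ m)) (m , from≤m (ρ m) , refl)
  where
  dne = em⇒dne em

¬acc⇒infiniteDescent : ExcludedMiddle ℓ → {A : Set ℓ} {_⊏_ : Rel A ℓ} →
  ∀ {x} → ¬ Acc _⊏_ x → ∃[ f ] InfiniteDescendingSequenceFrom _⊏_ f x
¬acc⇒infiniteDescent em {A} {_⊏_} {x} ¬acc =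
  proj₁ ∘ chain , refl , λ i → proj₁ (proj₂ (below (chain i)))
  where
  dne = em⇒dne em

  below : (p : Σ[ y ∈ A ] ¬ Acc _⊏_ y) →
          Σ[ z ∈ A ] z ⊏ proj₁ p × ¬ Acc _⊏_ z
  below (y , ¬a) = dne λ ¬∃ →
    ¬a (acc λ {z} z⊏y → dne λ ¬a′ → ¬∃ (z , z⊏y , ¬a′))

  chain : ℕ → Σ[ y ∈ A ] ¬ Acc _⊏_ y
  chain zero = x , ¬acc
  chain (suc i) with z , _ , ¬a ← below (chain i) = z , ¬a

-- Comparison of elements by their rank

module _ {A : Set ℓ} (_⊏_ : Rel A ℓ) where

  mutual
    -- The rank of x is below the rank of y, where the rank of an element is
    -- the least ordinal above the ranks of its predecessors.  As the definition
    -- is inductive, an inaccessible element is below no element.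
    data _≺_ (x y : A) : Set ℓ where
      via : ∀ {y′} → y′ ⊏ y → x ≼ y′ → x ≺ y

    -- The rank of x is at most the rank of y; this holds for no inaccessible x.
    _≼_ : Rel A ℓ
    x ≼ y = ∀ {x′} → x′ ⊏ x → x′ ≺ y

  -- Elements of the same rank, and any two inaccessible elements.
  _≈_ : Rel A ℓ
  x ≈ y = ¬ x ≺ y × ¬ y ≺ x

  ≺⇒acc : ∀ {x y} → x ≺ y → Acc _⊏_ x
  ≺⇒acc (via _ x≼y′) = acc λ x′⊏x → ≺⇒acc (x≼y′ x′⊏x)

  ≼-refl : ∀ {x} → Acc _⊏_ x → x ≼ x
  ≼-refl (acc rs) x′⊏x = via x′⊏x (≼-refl (rs x′⊏x))

  ⊏⇒≺ : ∀ {x y} → x ⊏ y → Acc _⊏_ x → x ≺ y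
  ⊏⇒≺ x⊏y a = via x⊏y (≼-refl a)

  ≺-≼-trans : ∀ {x y z} → x ≺ y → y ≼ z → x ≺ z
  ≺-≼-trans (via y′⊏y x≼y′) y≼z with via z′⊏z y′≼z′ ← y≼z y′⊏y =
    via z′⊏z λ x′⊏x → ≺-≼-trans (x≼y′ x′⊏x) y′≼z′

  ≺⇒≼ : ∀ {x y} → x ≺ y → x ≼ y
  ≺⇒≼ (via y′⊏y x≼y′) x′⊏x = via y′⊏y (≺⇒≼ (x≼y′ x′⊏x))

  ≺-trans : Transitive _≺_
  ≺-trans x≺y y≺z = ≺-≼-trans x≺y (≺⇒≼ y≺z)

  -- An element whose rank is at most that of an accessible element is
  -- accessible for the comparison of ranks.
  ≼⇒≺-acc : ∀ {x y} → Acc _⊏_ y → x ≼ y → Acc _≺_ x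
  ≼⇒≺-acc (acc rs) x≼y = acc λ { (via x′⊏x z≼x′) → below z≼x′ (x≼y x′⊏x) }
    where
    below : ∀ {z x′} → z ≼ x′ → x′ ≺ _ → Acc _≺_ z
    below z≼x′ (via y′⊏y x′≼y′) =
      ≼⇒≺-acc (rs y′⊏y) λ z′⊏z → ≺-≼-trans (z≼x′ z′⊏z) x′≼y′

  ≺-wellFounded : WellFounded _≺_
  ≺-wellFounded _ = acc λ z≺x →
    ≼⇒≺-acc (≺⇒acc z≺x) (≼-refl (≺⇒acc z≺x))

  ≺-asym : Asymmetric _≺_
  ≺-asym = wf⇒asym ≺-wellFounded

  module _ (em : ExcludedMiddle ℓ) where

    -- Negative transitivity of ≺, which makes ≈ transitive.
    ≺-weaklyLinear : ∀ {x z} → x ≺ z → ∀ y → x ≺ y ⊎ y ≺ z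
    ≺-weaklyLinear {x} {z} (via {z′} z′⊏z x≼z′) y with em {y ≺ z}
    ... | yes y≺z = inj₂ y≺z
    ... | no ¬y≺z = inj₁ (via (proj₁ (proj₂ ∃y′)) x≼y′)
      where
      -- As the rank of y is not at most that of z′, some y′ below y has at
      -- least the rank of z′, thus at least that of x.
      ∃y′ : ∃[ y′ ] y′ ⊏ y × ¬ y′ ≺ z′
      ∃y′ = em⇒dne em λ ¬∃ → ¬y≺z (via z′⊏z λ {y′} y′⊏y →
              em⇒dne em λ ¬y′≺z′ → ¬∃ (y′ , y′⊏y , ¬y′≺z′))

      x≼y′ : x ≼ proj₁ ∃y′
      x≼y′ x′⊏x with ≺-weaklyLinear (x≼z′ x′⊏x) (proj₁ ∃y′)
      ... | inj₁ x′≺y′ = x′≺y′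
      ... | inj₂ y′≺z′ = contradiction y′≺z′ (proj₂ (proj₂ ∃y′))

    ≈-isEquivalence : IsEquivalence _≈_
    ≈-isEquivalence = record
      { refl  = ≺-irrefl , ≺-irrefl
      ; sym   = λ (¬x≺y , ¬y≺x) → ¬y≺x , ¬x≺y
      ; trans = λ (¬x≺y , ¬y≺x) (¬y≺z , ¬z≺y) →
          ¬≺-trans ¬x≺y ¬y≺z , ¬≺-trans ¬z≺y ¬y≺x
      }
      where
      ≺-irrefl : ∀ {x} → ¬ x ≺ x
      ≺-irrefl x≺x = ≺-asym x≺x x≺x

      ¬≺-trans : ∀ {x y z} → ¬ x ≺ y → ¬ y ≺ z → ¬ x ≺ z
      ¬≺-trans {y = y} ¬x≺y ¬y≺z x≺z with ≺-weaklyLinear x≺z y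
      ... | inj₁ x≺y = ¬x≺y x≺y
      ... | inj₂ y≺z = ¬y≺z y≺z

    ≺-compare : Trichotomous _≈_ _≺_
    ≺-compare x y with em {x ≺ y}
    ... | yes x≺y = tri< x≺y (λ x≈y → proj₁ x≈y x≺y) (≺-asym x≺y)
    ... | no ¬x≺y with em {y ≺ x}
    ...   | yes y≺x = tri> ¬x≺y (λ x≈y → proj₂ x≈y y≺x) y≺x
    ...   | no ¬y≺x = tri≈ ¬x≺y (¬x≺y , ¬y≺x) ¬y≺x

    ≺-strictTotalOrder : StrictTotalOrder ℓ ℓ ℓ
    ≺-strictTotalOrder = record
      { isStrictTotalOrder = isStrictTotalOrderᶜ record
        { isEquivalence = ≈-isEquivalence
        ; trans         = ≺-trans
        ; compare       = ≺-compare
        }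
      }

-- The well-order of ranks with a top element

module _ {A : Set ℓ} (_⊏_ : Rel A ℓ) where

  -- ⊏ extended by a new element above all elements, including itself; so the
  -- new element is inaccessible and represents the greatest rank.
  open AddTop _⊏_ using ([_]; _≤⊤⁺) renaming (_≤⁺_ to _⊏⁺_)

  ⊤⁺-¬acc : ¬ Acc _⊏⁺_ ⊤⁺
  ⊤⁺-¬acc (acc rs) = ⊤⁺-¬acc (rs (⊤⁺ ≤⊤⁺))

  [-]-acc : ∀ {x} → Acc _⊏_ x → Acc _⊏⁺_ [ x ]
  [-]-acc (acc rs) = acc λ { [ y⊏x ] → [-]-acc (rs y⊏x) }

  acc⇒≺⊤⁺ : ∀ {x} → Acc _⊏⁺_ x → _≺_ _⊏⁺_ x ⊤⁺
  acc⇒≺⊤⁺ = ⊏⇒≺ _⊏⁺_ (_ ≤⊤⁺)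

  -- The carrier consists of the elements of A and the new one, an element
  -- standing for its rank.  So the map [_] sends each element of A to its rank,
  -- and each inaccessible element to a copy of the greatest rank.
  rankOrder : ExcludedMiddle ℓ → WellOrder∞ ℓ
  rankOrder em = record
    { strictTotalOrder = ≺-strictTotalOrder _⊏⁺_ em
    ; ≺-wellFounded    = ≺-wellFounded _⊏⁺_
    ; ∞                = ⊤⁺
    ; ≺∞               = λ w w≉⊤ → em⇒dne em λ ¬w≺⊤ →
        w≉⊤ (¬w≺⊤ , λ ⊤≺w → ⊤⁺-¬acc (≺⇒acc _⊏⁺_ ⊤≺w))
    }

  -- Being below any r whatsoever, as witnessed by the second premise, makes x
  -- accessible.
  ⊏⇒rank-decreases : ∀ {x y r} → y ⊏ x → _≺_ _⊏⁺_ [ x ] r →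
                     _≺_ _⊏⁺_ [ y ] [ x ]
  ⊏⇒rank-decreases y⊏x x≺r =
    ⊏⇒≺ _⊏⁺_ [ y⊏x ] (acc-inverse (≺⇒acc _⊏⁺_ x≺r) [ y⊏x ])

-- Executions of a program

module _ {S : Statements ℓ} (P : Program S) where
  open Statements S
  open Program P

  Configuration : Set ℓ
  Configuration = Loc × Valuation

  -- c′ ⟵ c: some edge of the program leads from c to c′.  The successor comes
  -- first, so that infinite executions are infinite descending sequences.
  _⟵_ : Rel Configuration ℓ
  (l′ , ν′) ⟵ (l , ν) = ∃[ st ] δ (l , st , l′) × ⟦ st ⟧ ν ν′

  Terminating⇒initial-acc : ExcludedMiddle ℓ → Terminating P →
                            ∀ ν → Acc _⟵_ (init , ν)
  Terminating⇒initial-acc em terminating ν = em⇒dne em λ ¬acc →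
    let c , c₀≡ , descending = ¬acc⇒infiniteDescent em ¬acc
    in terminating
         (proj₁ ∘ descending)
         ( proj₁ ∘ c
         , subst (λ d → proj₁ d ≡ init) (sym c₀≡) refl
         , proj₁ ∘ proj₂ ∘ descending )
         ( proj₂ ∘ c
         , proj₂ ∘ proj₂ ∘ descending )

-- The module of the paths that visit a given location infinitely often

  -- The location zero is the copy of the initial location, and suc l is the
  -- location l of the program.
  original : Fin (suc #locs) → Loc
  original zero    = init
  original (suc l) = l

  -- The copy has the edges that leave the initial location, and no edge enters
  -- the copy.
  copyδ : Fin (suc #locs) × Stmt × Fin (suc #locs) → Set
  copyδ (_ , _  , zero)   = ⊥
  copyδ (l , st , suc l′) = δ (original l , st , l′)

  copyδ⇒δ : ∀ l {st} l′ → copyδ (l , st , l′) →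
            δ (original l , st , original l′)
  copyδ⇒δ _ (suc _) d = d

  -- Its fair paths are those that visit the location k of the program
  -- infinitely often.
  recurrenceModule : Loc → Module S
  recurrenceModule k = record
    { program   = record { #locs = suc #locs ; δ = copyδ ; init = zero }
    ; fin       = suc k
    ; partition =
        U , ∁ U
      , p∪∁p≡⊤ U
      , (λ (_ , x∈U∩∁U) → let x∈U , x∈∁U = x∈p∩q⁻ U (∁ U) x∈U∩∁U
                         in x∈p⇒x∉∁p x∈U x∈∁U)
      , x∈⁅x⁆ zero
      , suc∈∁U
      , λ { {l′ = suc _} _ → inj₂ suc∈∁U }
    }
    where
    U = ⁅ zero {#locs} ⁆

    suc∈∁U : ∀ {l} → suc l ∈ ∁ U
    suc∈∁U = x∉p⇒x∈∁p (x≢y⇒x∉⁅y⁆ {y = zero} λ ())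

  fairTraces⊆traces : ∀ k → fairTraces (recurrenceModule k) ⊆ traces P
  fairTraces⊆traces k (ρ , (ρ₀≡zero , edges) , _) =
      original ∘ ρ
    , subst (λ l → original l ≡ init) (sym ρ₀≡zero) refl
    , λ i → copyδ⇒δ (ρ i) (ρ (suc i)) (edges i)

  traces⊆⋃fairTraces : ExcludedMiddle 0ℓ →
    traces P ⊆ ⋃ Loc (λ k → fairTraces (recurrenceModule k))
  traces⊆⋃fairTraces em {π} (ρ , ρ₀≡init , edges)
    with k , recurrent ← infinitePigeonhole em ρ =
      k , ρ′ , (refl , edges′) , recurrent′
    where
    ρ′ : ℕ → Fin (suc #locs)
    ρ′ zero    = zero
    ρ′ (suc i) = suc (ρ (suc i))

    edges′ : ∀ i → copyδ (ρ′ i , π i , ρ′ (suc i))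
    edges′ zero    = subst (λ l → δ (l , π 0 , ρ 1)) ρ₀≡init (edges 0)
    edges′ (suc i) = edges (suc i)

    -- A visit of ρ at position 0 is not one of ρ′, hence the visit taken
    -- is at or after position suc i.
    recurrent′ : ∀ i → ∃[ j ] i ≤ j × ρ′ j ≡ suc k
    recurrent′ i with recurrent (suc i)
    ... | suc j , i<j , refl = suc j , ≤-trans (n≤1+n i) i<j , refl

-- The rank certificate

  module _ (em : ExcludedMiddle ℓ) (terminating : Terminating P) where

    private
      ranks : WellOrder∞ ℓ
      ranks = rankOrder _⟵_ em

    open WellOrder∞ ranks using (∞; strictTotalOrder)
      renaming (_≺_ to _≺ʳ_; _≈_ to _≈ʳ_)
    open StrictTotalOrder strictTotalOrder
      using (module Eq; trans; <-respʳ-≈)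
    open Assertions S ranks

    initial≺∞ : ∀ ν → [ init , ν ] ≺ʳ ∞
    initial≺∞ ν =
      acc⇒≺⊤⁺ _⟵_ ([-]-acc _⟵_ (Terminating⇒initial-acc em terminating ν))

    -- At a location of the program, oldrnk exceeds the rank of the current
    -- configuration.  This does not depend on the final location of the module.
    certificate : Fin (suc #locs) → Predicate
    certificate zero = record
      { holds    = λ (ν , r) → r ≈ʳ ∞
      ; respects = λ (_ , r≈r′) r≈∞ → Eq.trans (Eq.sym r≈r′) r≈∞
      }
    certificate (suc l) = record
      { holds    = λ (ν , r) → [ l , ν ] ≺ʳ r
      ; respects = λ { (refl , r≈r′) rank≺r → <-respʳ-≈ r≈r′ rank≺r }
      }

    -- At the copy of the initial location, where oldrnk is ∞, oldrnk exceeds the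
    -- rank as well, since the program terminates.
    certificate⇒original≺ : ∀ l {ν r} → holds (certificate l) (ν , r) →
                            [ original l , ν ] ≺ʳ r
    certificate⇒original≺ zero    r≈∞    = <-respʳ-≈ (Eq.sym r≈∞) (initial≺∞ _)
    certificate⇒original≺ (suc l) rank≺r = rank≺r

    recurrenceCertified : Loc → CertifiedModule S
    recurrenceCertified k = record
      { module′ = recurrenceModule k
      ; W = ranks
      ; f = λ ν → [ k , ν ]
      ; I = certificate
      ; isRankCertificate = record
        { initial  = λ ν r → mk⇔ (λ r≈∞ → r≈∞) (λ r≈∞ → r≈∞)
        ; final    = λ ν r rank≺r → rank≺r
        ; step     = λ { {l} {st} {suc l′} d _ h (run , r≈r′) →
            let rank≺r = certificate⇒original≺ l h
            in <-respʳ-≈ r≈r′ (trans (decreases (st , d , run) rank≺r) rank≺r) }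
        ; step-fin = λ { {st} {suc l′} d rank≺r
                         (_ , (refl , r₁≈rank) , run , r₁≈r′) →
            <-respʳ-≈ (Eq.trans (Eq.sym r₁≈rank) r₁≈r′)
                      (decreases (st , d , run) rank≺r) }
        }
      }
      where
      decreases = ⊏⇒rank-decreases _⟵_

theorem2 : ∀ {ℓ : Level} → ExcludedMiddle ℓ →
    (S : Statements ℓ) (P : Program S) → Terminating P →
    Σ[ n ∈ ℕ ] Σ[ C ∈ (Fin n → CertifiedModule S) ]
    (traces P ≐ ⋃ (Fin n) (λ i → fairTraces (CertifiedModule.module′ (C i))))
theorem2 em S P terminating =
    Program.#locs P
  , recurrenceCertified P em terminating
  , traces⊆⋃fairTraces P (em₀ em)
  , λ (k , fair) → fairTraces⊆traces P k fair
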